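{- Let $V=\{0,\tfrac12,1\}$ and consider languages with a constant expressive semantics whose consequence relation is induced by one of the five intersective mixed consequence truth-relations $ss=\models_{\{1\},\{1\}}$, $tt=\models_{\{1,\frac12\},\{1,\frac12\}}$, $st=\models_{\{1\},\{1,\frac12\}}$, $ts=\models_{\{1,\frac12\},\{1\}}$, and $ss\cap tt$. Each of these five relations admits a G-disjunction and a G-conjunction. Each of $ss$, $tt$, $st$, $ts$ admits a G-negation and a G-conditional, whereas $ss\cap tt$ admits neither a G-negation nor a G-conditional.
   Context: $\models_{\mathcal{D}_p,\mathcal{D}_c}$ holds between $\gamma,\delta\subseteq V$ iff ($\gamma\subseteq\mathcal{D}_p\Rightarrow\delta\cap\mathcal{D}_c\neq\emptyset$). A semantics: set of valuations mapping atoms to $V$, interpreting each connective by a fixed truth function, extended compositionally, with every assignment of values to finitely many distinct atoms realized; constant expressive: every $\alpha\in V$ is the constant value of some formula. Induced consequence: $\Gamma\vdash\Delta$ iff $v(\Gamma)\models v(\Delta)$ for all valuations $v$; write $\Gamma,A$ for $\Gamma\cup\{A\}$. A relation admits a G-connective if some truth function, assigned to a connective, makes it satisfy, for all sets $\Gamma,\Delta$ and formulas $A,B$: G-conjunction: $\Gamma,A\wedge B\vdash\Delta$ iff $\Gamma,A,B\vdash\Delta$; $\Gamma\vdash A\wedge B,\Delta$ iff ($\Gamma\vdash A,\Delta$ and $\Gamma\vdash B,\Delta$). G-disjunction: $\Gamma\vdash A\vee B,\Delta$ iff $\Gamma\vdash A,B,\Delta$; $\Gamma,A\vee B\vdash\Delta$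 iff ($\Gamma,A\vdash\Delta$ and $\Gamma,B\vdash\Delta$). G-negation: $\Gamma,\neg A\vdash\Delta$ iff $\Gamma\vdash A,\Delta$; $\Gamma\vdash\neg A,\Delta$ iff $\Gamma,A\vdash\Delta$. G-conditional: $\Gamma\vdash A\to B,\Delta$ iff $\Gamma,A\vdash B,\Delta$; $\Gamma,A\to B\vdash\Delta$ iff ($\Gamma\vdash A,\Delta$ and $\Gamma,B\vdash\Delta$). -}

module Defs where

open import Data.Fin using (Fin)
open import Data.Maybe using (Maybe; just; nothing)
open import Data.Nat using (ℕ)
open import Data.Product using (_×_; ∃; ∃-syntax)
open import Data.Vec using (Vec; []; _∷_)
open import Function.Bundles using (_⇔_)
open import Function.Definitions using (Injective)
open import Level using (0ℓ; _⊔_) renaming (suc to lsuc)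
open import Relation.Binary using (Rel)
import Relation.Binary.Construct.Intersection as Rel
open import Relation.Binary.PropositionalEquality using (_≡_)
open import Relation.Unary using (Pred; _∈_; _⊆_; _∪_; _≬_; ｛_｝)

data V : Set where
  𝟎 ½ 𝟏 : V

TruthRelation : Set₁
TruthRelation = Rel (Pred V 0ℓ) 0ℓ

-- P ≬ Q says that P ∩ Q is inhabited.
mixed : Pred V 0ℓ → Pred V 0ℓ → TruthRelation
mixed Dₚ Dc γ δ = γ ⊆ Dₚ → δ ≬ Dc

strict tolerant : Pred V 0ℓ
strict   = ｛ 𝟏 ｝
tolerant = ｛ 𝟏 ｝ ∪ ｛ ½ ｝

ss tt st ts ss∩tt : TruthRelation
ss    = mixed strict strict
tt    = mixed tolerant tolerant
st    = mixed strict tolerant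
ts    = mixed tolerant strict
ss∩tt = ss Rel.∩ tt

TruthFunction : ℕ → Set
TruthFunction n = Vec V n → V

-- Valuations are given by their restrictions to atoms; eval extends them
-- compositionally.
record Semantics : Set₁ where
  field
    Atom      : Set
    Conn      : Set
    arity     : Conn → ℕ
    interp    : (c : Conn) → TruthFunction (arity c)
    Valuation : Pred (Atom → V) 0ℓ
    realized  : ∀ {n} (p : Fin n → Atom) → Injective _≡_ _≡_ p →
                (x : Fin n → V) →
                ∃[ v ] v ∈ Valuation × (∀ i → v (p i) ≡ x i)

  data Formula : Set where
    atom : Atom → Formula
    op   : (c : Conn) → Vec Formula (arity c) → Formula

  eval  : (Atom → V) → Formula → V
  evals : ∀ {n} → (Atom → V) → Vec Formula n → Vec V n

  eval v (atom p)  = v p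
  eval v (op c As) = interp c (evals v As)

  evals v []       = []
  evals v (A ∷ As) = eval v A ∷ evals v As

open Semantics

ConstantExpressive : Pred Semantics 0ℓ
ConstantExpressive S =
  ∀ α → ∃[ A ] (∀ v → v ∈ Valuation S → eval S v A ≡ α)

image : {A B : Set} → (A → B) → Pred A 0ℓ → Pred B 0ℓ
image f P y = ∃[ x ] x ∈ P × f x ≡ y

Consequence : (S : Semantics) → TruthRelation → Rel (Pred (Formula S) 0ℓ) 0ℓ
Consequence S _⊨_ Γ Δ =
  ∀ v → v ∈ Valuation S → image (eval S v) Γ ⊨ image (eval S v) Δ

-- The language of S enlarged by one new connective, interpreted by f.
_⊕_ : ∀ {n} → Semantics → TruthFunction n → Semantics
_⊕_ {n} S f = record
  { Atom      = Atom S
  ; Conn      = Maybe (Conn S)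
  ; arity     = arity⁺
  ; interp    = interp⁺
  ; Valuation = Valuation S
  ; realized  = realized S
  }
  where
  arity⁺ : Maybe (Conn S) → ℕ
  arity⁺ (just c) = arity S c
  arity⁺ nothing  = n

  interp⁺ : (c : Maybe (Conn S)) → TruthFunction (arity⁺ c)
  interp⁺ (just c) = interp S c
  interp⁺ nothing  = f

new : ∀ {n} (S : Semantics) (f : TruthFunction n) →
      Vec (Formula (S ⊕ f)) n → Formula (S ⊕ f)
new S f = op nothing

-- A property of an n-ary operation on formulas relative to a consequence
-- relation.
Rules : ℕ → Set₂
Rules n = (F : Set) → Rel (Pred F 0ℓ) 0ℓ → (Vec F n → F) → Set₁

GConjunction : Rules 2
GConjunction F _⊢_ ⋆ = ∀ Γ Δ A B →
    ((Γ ∪ ｛ A ∧ B ｝) ⊢ Δ  ⇔  (Γ ∪ ｛ A ｝ ∪ ｛ B ｝) ⊢ Δ)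
  × (Γ ⊢ (｛ A ∧ B ｝ ∪ Δ)  ⇔  (Γ ⊢ (｛ A ｝ ∪ Δ) × Γ ⊢ (｛ B ｝ ∪ Δ)))
  where
  _∧_ : F → F → F
  A ∧ B = ⋆ (A ∷ B ∷ [])

GDisjunction : Rules 2
GDisjunction F _⊢_ ⋆ = ∀ Γ Δ A B →
    (Γ ⊢ (｛ A ∨ B ｝ ∪ Δ)  ⇔  Γ ⊢ (｛ A ｝ ∪ ｛ B ｝ ∪ Δ))
  × ((Γ ∪ ｛ A ∨ B ｝) ⊢ Δ  ⇔  ((Γ ∪ ｛ A ｝) ⊢ Δ × (Γ ∪ ｛ B ｝) ⊢ Δ))
  where
  _∨_ : F → F → F
  A ∨ B = ⋆ (A ∷ B ∷ [])

GNegation : Rules 1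
GNegation F _⊢_ ⋆ = ∀ Γ Δ A →
    ((Γ ∪ ｛ neg A ｝) ⊢ Δ  ⇔  Γ ⊢ (｛ A ｝ ∪ Δ))
  × (Γ ⊢ (｛ neg A ｝ ∪ Δ)  ⇔  (Γ ∪ ｛ A ｝) ⊢ Δ)
  where
  neg : F → F
  neg A = ⋆ (A ∷ [])

GConditional : Rules 2
GConditional F _⊢_ ⋆ = ∀ Γ Δ A B →
    (Γ ⊢ (｛ A ⇒ B ｝ ∪ Δ)  ⇔  (Γ ∪ ｛ A ｝) ⊢ (｛ B ｝ ∪ Δ))
  × ((Γ ∪ ｛ A ⇒ B ｝) ⊢ Δ  ⇔  (Γ ⊢ (｛ A ｝ ∪ Δ) × (Γ ∪ ｛ B ｝) ⊢ Δ))
  where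
  _⇒_ : F → F → F
  A ⇒ B = ⋆ (A ∷ B ∷ [])

-- Over a class 𝓛 of semantics, one truth function has to work for every
-- member. Taking 𝓛 to be all constant expressive semantics makes admitting
-- strongest (a uniform truth function); taking 𝓛 to be a single semantics
-- makes not admitting strongest (every truth function fails there).
Admits : ∀ {ℓ n} → Pred Semantics ℓ → Rules n → TruthRelation → Set (lsuc 0ℓ ⊔ ℓ)
Admits {n = n} 𝓛 G R = ∃[ f ] (∀ S → S ∈ 𝓛 →
  G (Formula (S ⊕ f)) (Consequence (S ⊕ f) R) (new {n} S f))

{-# OPTIONS --safe #-}

-- For a fixed valuation and a fixed mixed relation ⊨_{P,C}, adding A to the
-- premises of a sequent makes it conditional on A ∈ P, and adding A to the
-- conclusions makes it conditional on A ∉ C. The G-rules thus reduce to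
-- conditions on truth functions, such as A → B ∉ C iff A ∈ P and B ∉ C, that
-- are decided by running through the truth tables.
--
-- For ss∩tt, constants satisfy A ⊢ B exactly when their values satisfy A ≤ B.
-- Let N be the negation of ½, respectively the conditional from ½ to 𝟎. As
-- ⊬ ½, the rules exclude N ⊢ ½, so N has value 𝟏; as ½ ⊬ and ½ ⊬ 𝟎, they
-- exclude ⊢ N, so N does not have value 𝟏.
module Submission where

open import Defs
open import Data.Bool using (Bool; true; false; if_then_else_)
open import Data.List using (List; []; _∷_)
open import Data.List.Relation.Unary.All using (All; []; _∷_)
open import Data.Maybe using (just)
open import Data.Nat using (ℕ)
open import Data.Product using (_×_; _,_; proj₁; proj₂; curry; uncurry)
open import Data.Product.Function.NonDependent.Propositional using (_×-⇔_)
open import Data.Sum using (_⊎_; inj₁; inj₂; [_,_])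
open import Data.Unit using (⊤)
open import Data.Vec using (Vec; []; _∷_)
open import Function using (_∘_)
open import Function.Bundles using (_⇔_; mk⇔; module Equivalence)
open import Function.Properties.Equivalence using (⇔-isEquivalence)
open import Function.Related.TypeIsomorphisms using (→-cong-⇔)
open import Level using (0ℓ)
open import Relation.Binary using (module IsEquivalence)
open import Relation.Binary.PropositionalEquality using (_≡_; _≢_; refl; sym; trans; cong; cong₂)
open import Relation.Nullary using (¬_; Dec; yes; no; contradiction)
open import Relation.Nullary.Decidable using (map′; ¬?; _×-dec_; _⊎-dec_; _→-dec_; True; toWitness; from-yes)
open import Relation.Unary using (Pred; Decidable; Satisfiable; _∈_; _∉_; _⊆_; _∪_; _≬_; _⊢_; ｛_｝; ∅)

open Semantics
open Equivalence using (to; from)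
open IsEquivalence (⇔-isEquivalence {0ℓ}) renaming (refl to ⇔-refl; sym to ⇔-sym; trans to ⇔-trans) using ()

-- Sequents under fixed standards for premises and conclusions.

private
  variable
    X Y Z : Set

currying : (X × Y → Z) ⇔ (X → Y → Z)
currying = mk⇔ curry uncurry

⊎-universal : (X ⊎ Y → Z) ⇔ ((X → Z) × (Y → Z))
⊎-universal = mk⇔ (λ h → h ∘ inj₁ , h ∘ inj₂) (λ (f , g) → [ f , g ])

module _ {F : Set} (P C : Pred F 0ℓ) where

  Sequent : Pred F 0ℓ → Pred F 0ℓ → Set
  Sequent Γ Δ = Γ ⊆ P → Δ ≬ C

  module _ {Γ Δ : Pred F 0ℓ} where

    left : ∀ {A} → Sequent (Γ ∪ ｛ A ｝) Δ ⇔ (A ∈ P → Sequent Γ Δ)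
    left {A} = mk⇔ forth back
      where
      forth : Sequent (Γ ∪ ｛ A ｝) Δ → A ∈ P → Sequent Γ Δ
      forth s a Γ⊆P = s λ { (inj₁ x) → Γ⊆P x ; (inj₂ refl) → a }

      back : (A ∈ P → Sequent Γ Δ) → Sequent (Γ ∪ ｛ A ｝) Δ
      back s ⊆P = s (⊆P (inj₂ refl)) (⊆P ∘ inj₁)

    left₂ : ∀ {A B} → Sequent (Γ ∪ ｛ A ｝ ∪ ｛ B ｝) Δ ⇔ (A ∈ P × B ∈ P → Sequent Γ Δ)
    left₂ {A} {B} = mk⇔ forth back
      where
      forth : Sequent (Γ ∪ ｛ A ｝ ∪ ｛ B ｝) Δ → A ∈ P × B ∈ P → Sequent Γ Δ
      forth s (a , b) Γ⊆P = s λ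
        { (inj₁ x) → Γ⊆P x ; (inj₂ (inj₁ refl)) → a ; (inj₂ (inj₂ refl)) → b }

      back : (A ∈ P × B ∈ P → Sequent Γ Δ) → Sequent (Γ ∪ ｛ A ｝ ∪ ｛ B ｝) Δ
      back s ⊆P = s (⊆P (inj₂ (inj₁ refl)) , ⊆P (inj₂ (inj₂ refl))) (⊆P ∘ inj₁)

    -- Inhabitation of `≬` is constructive, so the converse must produce a witness: `A` itself if it
    -- lies in `C`, otherwise the one found in `Δ`. This choice is what decidability of `C`
    -- provides.
    right : Decidable C → ∀ {A} → Sequent Γ (｛ A ｝ ∪ Δ) ⇔ (A ∉ C → Sequent Γ Δ)
    right C? {A} = mk⇔ forth back
      where
      forth : Sequent Γ (｛ A ｝ ∪ Δ) → A ∉ C → Sequent Γ Δ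
      forth s A∉C Γ⊆P with s Γ⊆P
      ... | _ , inj₁ refl , c = contradiction c A∉C
      ... | B , inj₂ B∈Δ  , c = B , B∈Δ , c

      back : (A ∉ C → Sequent Γ Δ) → Sequent Γ (｛ A ｝ ∪ Δ)
      back s Γ⊆P with C? A
      ... | yes c = A , inj₁ refl , c
      ... | no ¬c = let B , B∈Δ , c = s ¬c Γ⊆P in B , inj₂ B∈Δ , c

-- The tables speak of membership in `P` but non-membership in `C` because these are the guards that
-- a formula contributes as a premise and as a conclusion. Each half of a table matches one G-rule.
ConjunctionTable DisjunctionTable ConditionalTable : (P C : Pred V 0ℓ) → TruthFunction 2 → Set
ConjunctionTable P C f = ∀ a b → let c = f (a ∷ b ∷ []) in
  (c ∈ P ⇔ (a ∈ P × b ∈ P)) × (c ∉ C ⇔ (a ∉ C ⊎ b ∉ C))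
DisjunctionTable P C f = ∀ a b → let c = f (a ∷ b ∷ []) in
  (c ∈ P ⇔ (a ∈ P ⊎ b ∈ P)) × (c ∉ C ⇔ (a ∉ C × b ∉ C))
ConditionalTable P C f = ∀ a b → let c = f (a ∷ b ∷ []) in
  (c ∈ P ⇔ (a ∉ C ⊎ b ∈ P)) × (c ∉ C ⇔ (a ∈ P × b ∉ C))

NegationTable : (P C : Pred V 0ℓ) → TruthFunction 1 → Set
NegationTable P C f = ∀ a → let c = f (a ∷ []) in (c ∈ P ⇔ a ∉ C) × (c ∉ C ⇔ a ∈ P)

-- An indexed intersection treats a single mixed relation and `ss∩tt` uniformly: one truth function
-- then has to satisfy the table at every index.
record IntersectiveMixed (R : TruthRelation) : Set₁ where
  field
    Index   : Set
    Dₚ Dc   : Index → Pred V 0ℓ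
    Dc?     : ∀ i → Decidable (Dc i)
    R⇔mixed : ∀ {γ δ} → R γ δ ⇔ (∀ i → mixed (Dₚ i) (Dc i) γ δ)

-- Pulling the standards back along `e` replaces sets of values by sets of formulas, where adding a
-- formula is literally a union with a singleton.
mixed-image : ∀ {F : Set} (e : F → V) (P C : Pred V 0ℓ) {Γ Δ : Pred F 0ℓ} →
              mixed P C (image e Γ) (image e Δ) ⇔ Sequent (e ⊢ P) (e ⊢ C) Γ Δ
mixed-image e P C {Γ} {Δ} = mk⇔ forth back
  where
  forth : mixed P C (image e Γ) (image e Δ) → Sequent (e ⊢ P) (e ⊢ C) Γ Δ
  forth m Γ⊆P with m (λ { (_ , A∈Γ , refl) → Γ⊆P A∈Γ })
  ... | _ , (A , A∈Δ , refl) , c = A , A∈Δ , c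

  back : Sequent (e ⊢ P) (e ⊢ C) Γ Δ → mixed P C (image e Γ) (image e Δ)
  back s γ⊆P = let A , A∈Δ , c = s (λ A∈Γ → γ⊆P (_ , A∈Γ , refl)) in
    e A , (A , A∈Δ , refl) , c

-- From equivalences at each valuation and index to the G-rules.

module _ {R : TruthRelation} (mix : IntersectiveMixed R) where
  open IntersectiveMixed mix

  module Local (S : Semantics) (v : Atom S → V) (i : Index) where

    _∈ᵖ _∉ᶜ : Pred (Formula S) 0ℓ
    A ∈ᵖ = eval S v A ∈ Dₚ i
    A ∉ᶜ = eval S v A ∉ Dc i

    infix 4 _⊩_

    _⊩_ : (Γ Δ : Pred (Formula S) 0ℓ) → Set
    _⊩_ = Sequent (eval S v ⊢ Dₚ i) (eval S v ⊢ Dc i)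

    module _ {Γ Δ : Pred (Formula S) 0ℓ} where

      ⊩-left : ∀ {A} → (Γ ∪ ｛ A ｝ ⊩ Δ) ⇔ (A ∈ᵖ → Γ ⊩ Δ)
      ⊩-left = left (eval S v ⊢ Dₚ i) (eval S v ⊢ Dc i)

      ⊩-left₂ : ∀ {A B} → (Γ ∪ ｛ A ｝ ∪ ｛ B ｝ ⊩ Δ) ⇔ (A ∈ᵖ × B ∈ᵖ → Γ ⊩ Δ)
      ⊩-left₂ = left₂ (eval S v ⊢ Dₚ i) (eval S v ⊢ Dc i)

      ⊩-right : ∀ {A} → (Γ ⊩ ｛ A ｝ ∪ Δ) ⇔ (A ∉ᶜ → Γ ⊩ Δ)
      ⊩-right = right (eval S v ⊢ Dₚ i) (eval S v ⊢ Dc i) (Dc? i ∘ eval S v)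

      ⊩-left-by : ∀ {A} → A ∈ᵖ ⇔ X → (Γ ∪ ｛ A ｝ ⊩ Δ) ⇔ (X → Γ ⊩ Δ)
      ⊩-left-by A⇔X = ⇔-trans ⊩-left (→-cong-⇔ A⇔X ⇔-refl)

      ⊩-right-by : ∀ {A} → A ∉ᶜ ⇔ X → (Γ ⊩ ｛ A ｝ ∪ Δ) ⇔ (X → Γ ⊩ Δ)
      ⊩-right-by A⇔X = ⇔-trans ⊩-right (→-cong-⇔ A⇔X ⇔-refl)

  module _ (S : Semantics) where

    consequence⇔local : ∀ {Γ Δ} →
      Consequence S R Γ Δ ⇔ (∀ v → v ∈ Valuation S → ∀ i → Local._⊩_ S v i Γ Δ)
    consequence⇔local = mk⇔
      (λ c v v∈ i → to (mixed-image (eval S v) (Dₚ i) (Dc i)) (to R⇔mixed (c v v∈) i))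
      (λ l v v∈ → from R⇔mixed λ i → from (mixed-image (eval S v) (Dₚ i) (Dc i)) (l v v∈ i))

    globalise : ∀ {Γ Γ′ Δ Δ′} → (∀ v i → Local._⊩_ S v i Γ Δ ⇔ Local._⊩_ S v i Γ′ Δ′) →
                Consequence S R Γ Δ ⇔ Consequence S R Γ′ Δ′
    globalise h = ⇔-trans consequence⇔local (⇔-trans
      (mk⇔ (λ l v v∈ i → to (h v i) (l v v∈ i)) (λ l v v∈ i → from (h v i) (l v v∈ i)))
      (⇔-sym consequence⇔local))

    globalise-× : ∀ {Γ Γ′ Γ″ Δ Δ′ Δ″} →
                  (∀ v i → Local._⊩_ S v i Γ Δ ⇔ (Local._⊩_ S v i Γ′ Δ′ × Local._⊩_ S v i Γ″ Δ″)) →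
                  Consequence S R Γ Δ ⇔ (Consequence S R Γ′ Δ′ × Consequence S R Γ″ Δ″)
    globalise-× h = ⇔-trans consequence⇔local (⇔-trans
      (mk⇔ (λ l → (λ v v∈ i → proj₁ (to (h v i) (l v v∈ i))) , (λ v v∈ i → proj₂ (to (h v i) (l v v∈ i))))
           (λ (l , m) v v∈ i → from (h v i) (l v v∈ i , m v v∈ i)))
      (⇔-sym consequence⇔local ×-⇔ ⇔-sym consequence⇔local))

  module _ {ℓ} {𝓛 : Pred Semantics ℓ} where

    -- In this and the next three lemmas the table rewrites the guard of the compound formula. A
    -- conjunctive guard is then split into successive guards, and a disjunctive one into two
    -- sequents, which gives the rules with two premises.
    admitsGConjunction : ∀ f → (∀ i → ConjunctionTable (Dₚ i) (Dc i) f) → Admits 𝓛 GConjunction R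
    admitsGConjunction f table = f , λ S _ Γ Δ A B →
        globalise (S ⊕ f) (λ v i → let open Local (S ⊕ f) v i in
          ⇔-trans (⊩-left-by (proj₁ (table i (eval (S ⊕ f) v A) (eval (S ⊕ f) v B))))
            (⇔-sym ⊩-left₂))
      , globalise-× (S ⊕ f) (λ v i → let open Local (S ⊕ f) v i in
          ⇔-trans (⊩-right-by (proj₂ (table i (eval (S ⊕ f) v A) (eval (S ⊕ f) v B))))
            (⇔-trans ⊎-universal (⇔-sym ⊩-right ×-⇔ ⇔-sym ⊩-right)))

    admitsGDisjunction : ∀ f → (∀ i → DisjunctionTable (Dₚ i) (Dc i) f) → Admits 𝓛 GDisjunction R
    admitsGDisjunction f table = f , λ S _ Γ Δ A B →
        globalise (S ⊕ f) (λ v i → let open Local (S ⊕ f) v i in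
          ⇔-trans (⊩-right-by (proj₂ (table i (eval (S ⊕ f) v A) (eval (S ⊕ f) v B))))
            (⇔-trans currying (⇔-sym (⇔-trans ⊩-right (→-cong-⇔ ⇔-refl ⊩-right)))))
      , globalise-× (S ⊕ f) (λ v i → let open Local (S ⊕ f) v i in
          ⇔-trans (⊩-left-by (proj₁ (table i (eval (S ⊕ f) v A) (eval (S ⊕ f) v B))))
            (⇔-trans ⊎-universal (⇔-sym ⊩-left ×-⇔ ⇔-sym ⊩-left)))

    admitsGNegation : ∀ f → (∀ i → NegationTable (Dₚ i) (Dc i) f) → Admits 𝓛 GNegation R
    admitsGNegation f table = f , λ S _ Γ Δ A →
        globalise (S ⊕ f) (λ v i → let open Local (S ⊕ f) v i in
          ⇔-trans (⊩-left-by (proj₁ (table i (eval (S ⊕ f) v A))))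
            (⇔-sym ⊩-right))
      , globalise (S ⊕ f) (λ v i → let open Local (S ⊕ f) v i in
          ⇔-trans (⊩-right-by (proj₂ (table i (eval (S ⊕ f) v A))))
            (⇔-sym ⊩-left))

    admitsGConditional : ∀ f → (∀ i → ConditionalTable (Dₚ i) (Dc i) f) → Admits 𝓛 GConditional R
    admitsGConditional f table = f , λ S _ Γ Δ A B →
        globalise (S ⊕ f) (λ v i → let open Local (S ⊕ f) v i in
          ⇔-trans (⊩-right-by (proj₂ (table i (eval (S ⊕ f) v A) (eval (S ⊕ f) v B))))
            (⇔-trans currying (⇔-sym (⇔-trans ⊩-left (→-cong-⇔ ⇔-refl ⊩-right)))))
      , globalise-× (S ⊕ f) (λ v i → let open Local (S ⊕ f) v i in
          ⇔-trans (⊩-left-by (proj₁ (table i (eval (S ⊕ f) v A) (eval (S ⊕ f) v B))))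
            (⇔-trans ⊎-universal (⇔-sym ⊩-right ×-⇔ ⇔-sym ⊩-left)))

-- The five relations, decidable tables and the truth functions.

mixed-intersective : ∀ {P C} → Decidable C → IntersectiveMixed (mixed P C)
mixed-intersective {P} {C} C? = record
  { Index = ⊤ ; Dₚ = λ _ → P ; Dc = λ _ → C ; Dc? = λ _ → C?
  ; R⇔mixed = mk⇔ (λ m _ → m) (λ m → m _) }

strict? : Decidable strict
strict? 𝟎 = no λ ()
strict? ½ = no λ ()
strict? 𝟏 = yes refl

tolerant? : Decidable tolerant
tolerant? 𝟎 = no λ { (inj₁ ()) ; (inj₂ ()) }
tolerant? ½ = yes (inj₂ refl)
tolerant? 𝟏 = yes (inj₁ refl)

standard : Bool → Pred V 0ℓ
standard strictly = if strictly then strict else tolerant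

standard? : ∀ s → Decidable (standard s)
standard? true  = strict?
standard? false = tolerant?

ss∩tt-intersective : IntersectiveMixed ss∩tt
ss∩tt-intersective = record
  { Index = Bool ; Dₚ = standard ; Dc = standard ; Dc? = standard?
  ; R⇔mixed = mk⇔ (λ (s , t) → λ { true → s ; false → t }) (λ m → m true , m false) }

-- Finiteness of `V` makes every table decidable, so concrete tables are verified by evaluation.
∀V? : {Q : Pred V 0ℓ} → Decidable Q → Dec (∀ x → Q x)
∀V? Q? = map′ (λ (q₀ , q½ , q₁) → λ { 𝟎 → q₀ ; ½ → q½ ; 𝟏 → q₁ }) (λ q → q 𝟎 , q ½ , q 𝟏)
              (Q? 𝟎 ×-dec Q? ½ ×-dec Q? 𝟏)

infix 3 _⇔-dec_

_⇔-dec_ : Dec X → Dec Y → Dec (X ⇔ Y)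
x? ⇔-dec y? = map′ (uncurry mk⇔) (λ e → to e , from e) ((x? →-dec y?) ×-dec (y? →-dec x?))

module _ {P C : Pred V 0ℓ} (P? : Decidable P) (C? : Decidable C) where

  conjunctionTable? : Decidable (ConjunctionTable P C)
  conjunctionTable? f = ∀V? λ a → ∀V? λ b → let c = f (a ∷ b ∷ []) in
    (P? c ⇔-dec (P? a ×-dec P? b)) ×-dec (¬? (C? c) ⇔-dec (¬? (C? a) ⊎-dec ¬? (C? b)))

  disjunctionTable? : Decidable (DisjunctionTable P C)
  disjunctionTable? f = ∀V? λ a → ∀V? λ b → let c = f (a ∷ b ∷ []) in
    (P? c ⇔-dec (P? a ⊎-dec P? b)) ×-dec (¬? (C? c) ⇔-dec (¬? (C? a) ×-dec ¬? (C? b)))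

  conditionalTable? : Decidable (ConditionalTable P C)
  conditionalTable? f = ∀V? λ a → ∀V? λ b → let c = f (a ∷ b ∷ []) in
    (P? c ⇔-dec (¬? (C? a) ⊎-dec P? b)) ×-dec (¬? (C? c) ⇔-dec (P? a ×-dec ¬? (C? b)))

  negationTable? : Decidable (NegationTable P C)
  negationTable? f = ∀V? λ a → let c = f (a ∷ []) in
    (P? c ⇔-dec ¬? (C? a)) ×-dec (¬? (C? c) ⇔-dec P? a)

-- In the chain 𝟎 < ½ < 𝟏 both `strict` and `tolerant` are upward closed, so `min` meets either
-- standard iff both arguments do, and `max` iff one does. Hence the same pair serves all five
-- relations.
min max : TruthFunction 2
min (𝟎 ∷ b ∷ []) = 𝟎
min (½ ∷ 𝟎 ∷ []) = 𝟎
min (½ ∷ b ∷ []) = ½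
min (𝟏 ∷ b ∷ []) = b
max (𝟎 ∷ b ∷ []) = b
max (½ ∷ 𝟏 ∷ []) = 𝟏
max (½ ∷ b ∷ []) = ½
max (𝟏 ∷ b ∷ []) = 𝟏

-- For `ss` and `tt` the table fixes only whether the value is designated. For `st` and `ts` it
-- fixes the value itself: 𝟏 iff a is 𝟎 or b is 𝟏, and 𝟎 iff a is 𝟏 and b is 𝟎. This is the strong
-- Kleene conditional in both cases.
ss-conditional tt-conditional kleene-conditional : TruthFunction 2
ss-conditional (𝟏 ∷ b ∷ []) = b
ss-conditional (_ ∷ b ∷ []) = 𝟏
tt-conditional (𝟎 ∷ b ∷ []) = 𝟏
tt-conditional (_ ∷ b ∷ []) = b
kleene-conditional (𝟎 ∷ b ∷ []) = 𝟏
kleene-conditional (½ ∷ b ∷ []) = max (½ ∷ b ∷ [])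
kleene-conditional (𝟏 ∷ b ∷ []) = b

-- As 𝟎 meets neither standard, a conditional table with consequent 𝟎 becomes a negation table.
negation : TruthFunction 2 → TruthFunction 1
negation f (a ∷ []) = f (a ∷ 𝟎 ∷ [])

-- Constants in the enlarged language.

module Embedding (S : Semantics) {n : ℕ} (f : TruthFunction n) where

  embed  : Formula S → Formula (S ⊕ f)
  embeds : ∀ {k} → Vec (Formula S) k → Vec (Formula (S ⊕ f)) k

  embed (atom p)  = atom p
  embed (op c As) = op (just c) (embeds As)

  embeds []       = []
  embeds (A ∷ As) = embed A ∷ embeds As

  eval-embed  : ∀ v A → eval (S ⊕ f) v (embed A) ≡ eval S v A
  evals-embed : ∀ v {k} (As : Vec (Formula S) k) → evals (S ⊕ f) v (embeds As) ≡ evals S v As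

  eval-embed v (atom p)  = refl
  eval-embed v (op c As) = cong (interp S c) (evals-embed v As)

  evals-embed v []       = refl
  evals-embed v (A ∷ As) = cong₂ _∷_ (eval-embed v A) (evals-embed v As)

constantExpressive-⊕ : ∀ {S n} (f : TruthFunction n) →
                       S ∈ ConstantExpressive → S ⊕ f ∈ ConstantExpressive
constantExpressive-⊕ {S} f ce α = let A , A≡α = ce α in
  embed A , λ v v∈ → trans (eval-embed v A) (A≡α v v∈)
  where open Embedding S f

-- Realizing the empty family of atoms already yields a valuation; underivability is later refuted
-- at it.
someValuation : ∀ S → Satisfiable (Valuation S)
someValuation S = let v , v∈ , _ = realized S {0} (λ ()) (λ { {()} }) (λ ()) in v , v∈

-- The obstruction for the intersection.

module _ (S : Semantics) {h : Formula S} (h≡½ : ∀ v → v ∈ Valuation S → eval S v h ≡ ½) where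

  private
    infix 4 _⊢∩_
    _⊢∩_ : (Γ Δ : Pred (Formula S) 0ℓ) → Set
    _⊢∩_ = Consequence S ss∩tt

    local : ∀ {Γ Δ} → Γ ⊢∩ Δ ⇔ (∀ v → v ∈ Valuation S → ∀ s →
            Sequent (eval S v ⊢ standard s) (eval S v ⊢ standard s) Γ Δ)
    local = consequence⇔local ss∩tt-intersective S

  -- The `ss` component fails, since ½ is not strict. The doubled conclusion is the form in which
  -- the left rules deliver the sequent when `Δ` is already `｛ h ｝`.
  ⊬½ : ¬ (∅ ⊢∩ ｛ h ｝ ∪ ｛ h ｝)
  ⊬½ c with v , v∈ ← someValuation S with to local c v v∈ true (λ ())
  ... | _ , inj₁ refl , 𝟏≡h = contradiction (trans 𝟏≡h (h≡½ v v∈)) λ ()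
  ... | _ , inj₂ refl , 𝟏≡h = contradiction (trans 𝟏≡h (h≡½ v v∈)) λ ()

  -- Here the `tt` component fails: the premise is tolerant and no conclusion is.
  ½⊬𝟎s : ∀ {Θ} → (∀ {A} → A ∈ Θ → ∀ v → v ∈ Valuation S → eval S v A ≡ 𝟎) → ¬ (∅ ∪ ｛ h ｝ ⊢∩ Θ)
  ½⊬𝟎s Θ≡𝟎 c with v , v∈ ← someValuation S
    with to local c v v∈ false (λ { (inj₂ refl) → inj₂ (sym (h≡½ v v∈)) })
  ... | _ , A∈Θ , inj₁ 𝟏≡A = contradiction (trans 𝟏≡A (Θ≡𝟎 A∈Θ v v∈)) λ ()
  ... | _ , A∈Θ , inj₂ ½≡A = contradiction (trans ½≡A (Θ≡𝟎 A∈Θ v v∈)) λ ()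

  module _ {N : Formula S} {β : V} (N≡β : ∀ v → v ∈ Valuation S → eval S v N ≡ β) where

    -- The `ss` component holds because its premise is not strict, the `tt` component because ½ is
    -- tolerant.
    N⊢½ : β ≢ 𝟏 → ∅ ∪ ｛ N ｝ ⊢∩ ｛ h ｝
    N⊢½ β≢𝟏 = from local λ where
      v v∈ true  ⊆P → contradiction (sym (trans (⊆P (inj₂ refl)) (N≡β v v∈))) β≢𝟏
      v v∈ false ⊆P → h , refl , inj₂ (sym (h≡½ v v∈))

    ⊢N : β ≡ 𝟏 → ∅ ⊢∩ ｛ N ｝ ∪ ∅
    ⊢N refl = from local λ where
      v v∈ true  _ → N , inj₁ refl , sym (N≡β v v∈)
      v v∈ false _ → N , inj₁ refl , inj₁ (sym (N≡β v v∈))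

    -- Θ is ∅ for the negation of ½ and {𝟎} for the conditional from ½ to 𝟎.
    ss∩tt-obstruction : ∀ {Θ} → (∀ {A} → A ∈ Θ → ∀ v → v ∈ Valuation S → eval S v A ≡ 𝟎) →
      (∅ ∪ ｛ N ｝ ⊢∩ ｛ h ｝ → ∅ ⊢∩ ｛ h ｝ ∪ ｛ h ｝) → ¬ (∅ ⊢∩ ｛ N ｝ ∪ ∅ → ∅ ∪ ｛ h ｝ ⊢∩ Θ)
    ss∩tt-obstruction Θ≡𝟎 ruleˡ ruleʳ with strict? β
    ... | yes 𝟏≡β = ½⊬𝟎s Θ≡𝟎 (ruleʳ (⊢N (sym 𝟏≡β)))
    ... | no  𝟏≢β = ⊬½ (ruleˡ (N⊢½ (𝟏≢β ∘ sym)))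

module _ {ℓ} {𝓛 : Pred Semantics ℓ} (𝓛⊆CE : 𝓛 ⊆ ConstantExpressive) (𝓛≢∅ : Satisfiable 𝓛) where

  ¬admitsGNegation : ¬ Admits 𝓛 GNegation ss∩tt
  ¬admitsGNegation (f , rules) =
    let S , S∈𝓛 = 𝓛≢∅
        h , h≡½ = constantExpressive-⊕ f (𝓛⊆CE S∈𝓛) ½
        rule : GNegation _ (Consequence (S ⊕ f) ss∩tt) (new S f)
        rule = rules S S∈𝓛
    -- Whatever `f` is, the negation of a constant is constant.
    in ss∩tt-obstruction (S ⊕ f) h≡½ (λ v v∈ → cong (λ a → f (a ∷ [])) (h≡½ v v∈))
         (λ ())
         (to (proj₁ (rule ∅ ｛ h ｝ h)))
         (to (proj₂ (rule ∅ ∅ h)))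

  ¬admitsGConditional : ¬ Admits 𝓛 GConditional ss∩tt
  ¬admitsGConditional (f , rules) =
    let S , S∈𝓛 = 𝓛≢∅
        h , h≡½ = constantExpressive-⊕ f (𝓛⊆CE S∈𝓛) ½
        z , z≡𝟎 = constantExpressive-⊕ f (𝓛⊆CE S∈𝓛) 𝟎
        rule : GConditional _ (Consequence (S ⊕ f) ss∩tt) (new S f)
        rule = rules S S∈𝓛
    in ss∩tt-obstruction (S ⊕ f) h≡½ (λ v v∈ → cong₂ (λ a b → f (a ∷ b ∷ [])) (h≡½ v v∈) (z≡𝟎 v v∈))
         (λ { (inj₁ refl) → z≡𝟎 })
         -- Of the two sequents given by the left rule, the one with the antecedent ½ as a
         -- conclusion is the underivable one.
         (proj₁ ∘ to (proj₂ (rule ∅ ｛ h ｝ h z)))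
         (to (proj₁ (rule ∅ ∅ h z)))

module _ {ℓ} {𝓛 : Pred Semantics ℓ} {P C : Pred V 0ℓ} (P? : Decidable P) (C? : Decidable C) where

  -- For concrete standards the implicit `True` arguments compute to the unit type and are filled in
  -- automatically.
  mixed-admits-∨-∧ : {_ : True (disjunctionTable? P? C? max)} {_ : True (conjunctionTable? P? C? min)} →
    Admits 𝓛 GDisjunction (mixed P C) × Admits 𝓛 GConjunction (mixed P C)
  mixed-admits-∨-∧ {d} {c} =
      admitsGDisjunction (mixed-intersective C?) max (λ _ → toWitness d)
    , admitsGConjunction (mixed-intersective C?) min (λ _ → toWitness c)

  mixed-admits-¬-→ : ∀ f → {_ : True (negationTable? P? C? (negation f))} {_ : True (conditionalTable? P? C? f)} →
    Admits 𝓛 GNegation (mixed P C) × Admits 𝓛 GConditional (mixed P C)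
  mixed-admits-¬-→ f {n} {c} =
      admitsGNegation (mixed-intersective C?) (negation f) (λ _ → toWitness n)
    , admitsGConditional (mixed-intersective C?) f (λ _ → toWitness c)

ss∩tt-admits-∨-∧ : ∀ {ℓ} {𝓛 : Pred Semantics ℓ} → Admits 𝓛 GDisjunction ss∩tt × Admits 𝓛 GConjunction ss∩tt
ss∩tt-admits-∨-∧ =
    admitsGDisjunction ss∩tt-intersective max (λ where
      true  → from-yes (disjunctionTable? strict? strict? max)
      false → from-yes (disjunctionTable? tolerant? tolerant? max))
  , admitsGConjunction ss∩tt-intersective min (λ where
      true  → from-yes (conjunctionTable? strict? strict? min)
      false → from-yes (conjunctionTable? tolerant? tolerant? min))

theorem4p1 : ∀ {ℓ} (𝓛 : Pred Semantics ℓ) → 𝓛 ⊆ ConstantExpressive → Satisfiable 𝓛 →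
    All (λ R → Admits 𝓛 GDisjunction R × Admits 𝓛 GConjunction R) (ss ∷ tt ∷ st ∷ ts ∷ ss∩tt ∷ [])
    × All (λ R → Admits 𝓛 GNegation R × Admits 𝓛 GConditional R) (ss ∷ tt ∷ st ∷ ts ∷ [])
    × ¬ Admits 𝓛 GNegation ss∩tt
    × ¬ Admits 𝓛 GConditional ss∩tt
theorem4p1 𝓛 𝓛⊆CE 𝓛≢∅ =
    ( mixed-admits-∨-∧ strict? strict?
    ∷ mixed-admits-∨-∧ tolerant? tolerant?
    ∷ mixed-admits-∨-∧ strict? tolerant?
    ∷ mixed-admits-∨-∧ tolerant? strict?
    ∷ ss∩tt-admits-∨-∧
    ∷ [])
  , ( mixed-admits-¬-→ strict? strict? ss-conditional
    ∷ mixed-admits-¬-→ tolerant? tolerant? tt-conditional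
    ∷ mixed-admits-¬-→ strict? tolerant? kleene-conditional
    ∷ mixed-admits-¬-→ tolerant? strict? kleene-conditional
    ∷ [])
  , ¬admitsGNegation 𝓛⊆CE 𝓛≢∅
  , ¬admitsGConditional 𝓛⊆CE 𝓛≢∅
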